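{- Let $\mathcal{Q}$ be a small quantaloid. Then $\mathsf{K}=\mathsf{M}\circ(-)^{\triangleright}$ as functors $(\mathcal{Q}\text{ - }\mathbf{Chu})^{\mathrm{op}}\to\mathcal{Q}\text{ - }\mathbf{Sup}$; that is, the triangle formed by $(-)^{\triangleright}:(\mathcal{Q}\text{ - }\mathbf{Chu})^{\mathrm{op}}\to\mathcal{Q}\text{ - }\mathbf{Chu}$, $\mathsf{M}:\mathcal{Q}\text{ - }\mathbf{Chu}\to\mathcal{Q}\text{ - }\mathbf{Sup}$ and $\mathsf{K}:(\mathcal{Q}\text{ - }\mathbf{Chu})^{\mathrm{op}}\to\mathcal{Q}\text{ - }\mathbf{Sup}$ is commutative.
   Context: A quantaloid $\mathcal{Q}$ is a category whose hom-sets are complete lattices and whose composition $\circ$ preserves joins in each variable; small means it has a set $\mathcal{Q}_0$ of objects; $1_q$ denotes identities. For $u:p\to q$, $v:q\to r$, $w:p\to r$, the implications $w\swarrow u:q\to r$ and $v\searrow w:p\to q$ are determined by $v\circ u\leq w\iff v\leq w\swarrow u\iff u\leq v\searrow w$. A $\mathcal{Q}$-category $\mathbb{A}$ is a set $\mathbb{A}_0$ with a type map $|\cdot|:\mathbb{A}_0\to\mathcal{Q}_0$ and arrows $\mathbb{A}(x,y)\in\mathcal{Q}(|x|,|y|)$ such that $1_{|x|}\leq\mathbb{A}(x,x)$ and $\mathbb{A}(y,z)\circ\mathbb{A}(x,y)\leq\mathbb{A}(x,z)$. A $\mathcal{Q}$-subcategory is a subset of objects with the same hom-arrows. $x\leq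 y$ iff $|x|=|y|$ and $1_{|x|}\leq\mathbb{A}(x,y)$; $\mathbb{A}$ is separated if $x\leq y$ and $y\leq x$ imply $x=y$. A $\mathcal{Q}$-functor $F:\mathbb{A}\to\mathbb{B}$ is a type-preserving map $\mathbb{A}_0\to\mathbb{B}_0$ with $\mathbb{A}(x,x')\leq\mathbb{B}(Fx,Fx')$; $\mathcal{Q}$-functors are ordered pointwise; $F:\mathbb{A}\to\mathbb{B}$ is a left adjoint if there is $G:\mathbb{B}\to\mathbb{A}$ with $1_{\mathbb{A}}\leq GF$, $FG\leq1_{\mathbb{B}}$. A $\mathcal{Q}$-distributor $\phi:\mathbb{A}\nrightarrow\mathbb{B}$ is a family of arrows $\phi(x,y):|x|\to|y|$ with $\mathbb{B}(y,y')\circ\phi(x,y)\circ\mathbb{A}(x',x)\leq\phi(x',y')$. For $\phi:\mathbb{A}\nrightarrow\mathbb{B}$, $\psi:\mathbb{B}\nrightarrow\mathbb{C}$, $\xi:\mathbb{A}\nrightarrow\mathbb{C}$: $(\psi\circ\phi)(x,z)=\bigvee_{y}\psi(y,z)\circ\phi(x,y)$, $(\xi\swarrow\phi)(y,z)=\bigwedge_{x}\xi(x,z)\swarrow\phi(x,y)$, $(\psi\searrow\xi)(x,y)=\bigwedge_{z}\psi(y,z)\searrow\xi(x,z)$. For $F:\mathbb{A}\to\mathbb{B}$: $F_\natural(x,y)=\mathbb{B}(Fx,y)$ (a distributor $\mathbb{A}\nrightarrow\mathbb{B}$), $F^\natural(y,x)=\mathbb{B}(y,Fx)$ (a distributor $\mathbb{B}\nrightarrow\mathbb{A}$).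 $\{q\}$ is the $\mathcal{Q}$-category with one object of type $q$ and hom-arrow $1_q$. $\mathsf{P}\mathbb{A}$ is the $\mathcal{Q}$-category of presheaves $\mu:\mathbb{A}\nrightarrow\{q\}$ (of type $q$) with $\mathsf{P}\mathbb{A}(\mu,\mu')=\mu'\swarrow\mu$; $\mathsf{P}^\dagger\mathbb{A}$ is the $\mathcal{Q}$-category of copresheaves $\lambda:\{q\}\nrightarrow\mathbb{A}$ (of type $q$) with $\mathsf{P}^\dagger\mathbb{A}(\lambda,\lambda')=\lambda'\searrow\lambda$. $\mathbb{A}$ is complete if every $\mu\in\mathsf{P}\mathbb{A}$ has a supremum, i.e. an object $\sup\mu$ of type $|\mu|$ with $\mathbb{A}(\sup\mu,-)=\mathbb{A}\swarrow\mu$. For $\phi:\mathbb{A}\nrightarrow\mathbb{B}$ put $\phi_{\uparrow}:\mathsf{P}\mathbb{A}\to\mathsf{P}^\dagger\mathbb{B}$, $\phi_\uparrow\mu=\phi\swarrow\mu$; $\phi^{\downarrow}:\mathsf{P}^\dagger\mathbb{B}\to\mathsf{P}\mathbb{A}$, $\phi^\downarrow\lambda=\lambda\searrow\phi$; $\phi^*:\mathsf{P}\mathbb{B}\to\mathsf{P}\mathbb{A}$, $\phi^*\lambda=\lambda\circ\phi$; $\phi_*:\mathsf{P}\mathbb{A}\to\mathsf{P}\mathbb{B}$, $\phi_*\mu=\mu\swarrow\phi$. Let $\mathsf{M}\phi=\{\mu\in\mathsf{P}\mathbb{A}\mid\phi^\downarrow\phi_\uparrow\mu=\mu\}$ and $\mathsf{K}\phi=\{\lambda\in\mathsf{P}\mathbb{B}\mid\phi_*\phi^*\lambda=\lambda\}$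 (as $\mathcal{Q}$-subcategories); both are separated complete. $\overline{\mathbb{A}}$ is the $\mathcal{Q}$-subcategory of $\mathsf{P}\mathbb{A}$ of presheaves of the form $u\swarrow\mathbb{A}(a,-)$ with $a\in\mathbb{A}_0$ and $u$ a $\mathcal{Q}$-arrow with domain $|a|$; $\mathbb{A}^\triangleright:\mathbb{A}\nrightarrow\overline{\mathbb{A}}$ is $\mathbb{A}^\triangleright(a,\mu)=\mu(a)$; $\phi^\triangleright:=\mathbb{A}^\triangleright\swarrow\phi:\mathbb{B}\nrightarrow\overline{\mathbb{A}}$. $\mathcal{Q}\text{ - }\mathbf{Chu}$ has $\mathcal{Q}$-distributors as objects; a morphism (Chu transform) $(F,G):(\phi:\mathbb{A}\nrightarrow\mathbb{B})\to(\psi:\mathbb{A}'\nrightarrow\mathbb{B}')$ consists of $\mathcal{Q}$-functors $F:\mathbb{A}\to\mathbb{A}'$, $G:\mathbb{B}'\to\mathbb{B}$ with $\psi(Fa,b')=\phi(a,Gb')$ for all $a\in\mathbb{A}_0$, $b'\in\mathbb{B}'_0$. $\mathcal{Q}\text{ - }\mathbf{Sup}$ is the category of separated complete $\mathcal{Q}$-categories and left adjoint $\mathcal{Q}$-functors. The functor $(-)^\triangleright$ sends $\phi$ to $\phi^\triangleright$ and $(F,G):\phi\to\psi$ to $(G,(F_\natural)_*):\psi^\triangleright\to\phi^\triangleright$, where $(F_\natural)_*:\overline{\mathbb{A}}\to\overline{\mathbb{A}'}$ is the restriction of $(F_\natural)_*:\mathsf{P}\mathbb{A}\to\mathsf{P}\mathbb{A}'$.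 The functor $\mathsf{M}$ sends $\phi$ to $\mathsf{M}\phi$ and $(F,G):\phi\to\psi$ to $\psi^\downarrow\psi_\uparrow(F^\natural)^*:\mathsf{M}\phi\to\mathsf{M}\psi$. The functor $\mathsf{K}$ sends $\phi$ to $\mathsf{K}\phi$ and $(F,G):\phi\to\psi$ to $\phi_*\phi^*(G^\natural)^*:\mathsf{K}\psi\to\mathsf{K}\phi$. -}

module Defs where

open import Level using (Level; _⊔_; suc; Lift; lift)
open import Data.Bool using (Bool; true; false)
open import Data.Product using (Σ; Σ-syntax; _×_; _,_; proj₁; proj₂)
open import Function.Bundles using (_⇔_)
open import Relation.Binary using (Setoid; Poset; IsEquivalence)
open import Relation.Binary.PropositionalEquality as ≡ using (_≡_)

record Category o m e : Set (suc (o ⊔ m ⊔ e)) where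
  infix  4 _≈_
  infixr 9 _∘_
  field
    Obj       : Set o
    Hom       : Obj → Obj → Set m
    _≈_       : ∀ {X Y} → Hom X Y → Hom X Y → Set e
    equiv     : ∀ {X Y} → IsEquivalence (_≈_ {X} {Y})
    id        : ∀ {X} → Hom X X
    _∘_       : ∀ {X Y Z} → Hom Y Z → Hom X Y → Hom X Z
    ∘-cong    : ∀ {X Y Z} {g g′ : Hom Y Z} {f f′ : Hom X Y} →
                g ≈ g′ → f ≈ f′ → g ∘ f ≈ g′ ∘ f′
    assoc     : ∀ {W X Y Z} (h : Hom Y Z) (g : Hom X Y) (f : Hom W X) →
                (h ∘ g) ∘ f ≈ h ∘ (g ∘ f)
    identityˡ : ∀ {X Y} (f : Hom X Y) → id ∘ f ≈ f
    identityʳ : ∀ {X Y} (f : Hom X Y) → f ∘ id ≈ f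

op : ∀ {o m e} → Category o m e → Category o m e
op C = record
  { Obj       = Obj
  ; Hom       = λ X Y → Hom Y X
  ; _≈_       = _≈_
  ; equiv     = equiv
  ; id        = id
  ; _∘_       = λ g f → f ∘ g
  ; ∘-cong    = λ p q → ∘-cong q p
  ; assoc     = λ h g f → IsEquivalence.sym equiv (assoc f g h)
  ; identityˡ = identityʳ
  ; identityʳ = identityˡ
  } where open Category C

record Functor {o m e o′ m′ e′} (C : Category o m e) (D : Category o′ m′ e′)
       : Set (o ⊔ m ⊔ e ⊔ o′ ⊔ m′ ⊔ e′) where
  private
    module C = Category C
    module D = Category D
  field
    F₀           : C.Obj → D.Obj
    F₁           : ∀ {X Y} → C.Hom X Y → D.Hom (F₀ X) (F₀ Y)
    cong         : ∀ {X Y} {f g : C.Hom X Y} → f C.≈ g → F₁ f D.≈ F₁ g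
    identity     : ∀ {X} → F₁ (C.id {X}) D.≈ D.id
    homomorphism : ∀ {X Y Z} (g : C.Hom Y Z) (f : C.Hom X Y) →
                   F₁ (g C.∘ f) D.≈ F₁ g D.∘ F₁ f

infixr 9 _∘F_

_∘F_ : ∀ {o m e o′ m′ e′ o″ m″ e″}
       {C : Category o m e} {D : Category o′ m′ e′} {E : Category o″ m″ e″} →
       Functor D E → Functor C D → Functor C E
_∘F_ {E = E} G F = record
  { F₀           = λ X → G.F₀ (F.F₀ X)
  ; F₁           = λ f → G.F₁ (F.F₁ f)
  ; cong         = λ p → G.cong (F.cong p)
  ; identity     = trans (G.cong F.identity) G.identity
  ; homomorphism = λ g f → trans (G.cong (F.homomorphism g f)) (G.homomorphism _ _)
  }
  where
  module G = Functor G
  module F = Functor F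
  trans : ∀ {X Y} {f g h : Category.Hom E X Y} →
          Category._≈_ E f g → Category._≈_ E g h → Category._≈_ E f h
  trans = IsEquivalence.trans (Category.equiv E)

-- Joins are taken over families indexed by types in the universe of the
-- carrier.  This is the same as having joins of all subsets S : Carrier → Set ℓ.
-- A single universe is used for objects, arrows and index types, because joins
-- and meets over sets of presheaves, which contain families of arrows, are needed.

record CompleteLattice ℓ : Set (suc ℓ) where
  field
    poset : Poset ℓ ℓ ℓ
  open Poset poset public
  field
    ⋁       : {I : Set ℓ} → (I → Carrier) → Carrier
    ⋁-upper : {I : Set ℓ} (f : I → Carrier) (i : I) → f i ≤ ⋁ f
    ⋁-least : {I : Set ℓ} (f : I → Carrier) {u : Carrier} →
              (∀ i → f i ≤ u) → ⋁ f ≤ u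

  ⋀ : {I : Set ℓ} → (I → Carrier) → Carrier
  ⋀ {I} f = ⋁ {I = Σ[ u ∈ Carrier ] (∀ i → u ≤ f i)} proj₁

  ⋀-lower : {I : Set ℓ} (f : I → Carrier) (i : I) → ⋀ f ≤ f i
  ⋀-lower f i = ⋁-least _ λ { (u , p) → p i }

  ⋀-greatest : {I : Set ℓ} (f : I → Carrier) {u : Carrier} →
               (∀ i → u ≤ f i) → u ≤ ⋀ f
  ⋀-greatest f {u} p = ⋁-upper _ (u , p)

record Quantaloid ℓ : Set (suc ℓ) where
  infix  4 _≤_ _≈_
  infixr 9 _∘_
  field
    Ob      : Set ℓ
    lattice : Ob → Ob → CompleteLattice ℓ

  Hom : Ob → Ob → Set ℓ
  Hom p q = CompleteLattice.Carrier (lattice p q)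

  _≤_ : ∀ {p q} → Hom p q → Hom p q → Set ℓ
  _≤_ {p} {q} = CompleteLattice._≤_ (lattice p q)

  _≈_ : ∀ {p q} → Hom p q → Hom p q → Set ℓ
  _≈_ {p} {q} = CompleteLattice._≈_ (lattice p q)

  ⋁ : ∀ {p q} {I : Set ℓ} → (I → Hom p q) → Hom p q
  ⋁ {p} {q} = CompleteLattice.⋁ (lattice p q)

  ⋀ : ∀ {p q} {I : Set ℓ} → (I → Hom p q) → Hom p q
  ⋀ {p} {q} = CompleteLattice.⋀ (lattice p q)

  field
    id        : ∀ {p} → Hom p p
    _∘_       : ∀ {p q r} → Hom q r → Hom p q → Hom p r
    ∘-cong    : ∀ {p q r} {v v′ : Hom q r} {u u′ : Hom p q} →
                v ≈ v′ → u ≈ u′ → v ∘ u ≈ v′ ∘ u′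
    assoc     : ∀ {p q r s} (w : Hom r s) (v : Hom q r) (u : Hom p q) →
                (w ∘ v) ∘ u ≈ w ∘ (v ∘ u)
    identityˡ : ∀ {p q} (u : Hom p q) → id ∘ u ≈ u
    identityʳ : ∀ {p q} (u : Hom p q) → u ∘ id ≈ u
    ∘-⋁ˡ      : ∀ {p q r} {I : Set ℓ} (v : Hom q r) (u : I → Hom p q) →
                v ∘ ⋁ u ≈ ⋁ λ i → v ∘ u i
    ∘-⋁ʳ      : ∀ {p q r} {I : Set ℓ} (v : I → Hom q r) (u : Hom p q) →
                ⋁ v ∘ u ≈ ⋁ λ i → v i ∘ u

  infix 8 _↙_ _↘_

  _↙_ : ∀ {p q r} → Hom p r → Hom p q → Hom q r
  _↙_ {p} {q} {r} w u = ⋁ {I = Σ[ v ∈ Hom q r ] v ∘ u ≤ w} proj₁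

  _↘_ : ∀ {p q r} → Hom q r → Hom p r → Hom p q
  _↘_ {p} {q} {r} v w = ⋁ {I = Σ[ u ∈ Hom p q ] v ∘ u ≤ w} proj₁

module QuantaloidProperties {ℓ} (Q : Quantaloid ℓ) where
  open Quantaloid Q

  module _ {p q : Ob} where
    open CompleteLattice (lattice p q) public
      using (antisym; module Eq; ⋁-upper; ⋁-least; ⋀-lower; ⋀-greatest)
      renaming (refl to ≤-refl; trans to ≤-trans; reflexive to ≤-reflexive)
    open Eq public using ()
      renaming (refl to ≈-refl; sym to ≈-sym; trans to ≈-trans)

  infixr 2 _⨾_
  _⨾_ : ∀ {p q} {u v w : Hom p q} → u ≤ v → v ≤ w → u ≤ w
  _⨾_ = ≤-trans

  ≥-reflexive : ∀ {p q} {u v : Hom p q} → u ≈ v → v ≤ u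
  ≥-reflexive e = ≤-reflexive (≈-sym e)

  private
    pair : ∀ {p q} → Hom p q → Hom p q → Lift ℓ Bool → Hom p q
    pair u v (lift false) = u
    pair u v (lift true)  = v

    ⋁-pair : ∀ {p q} {u v : Hom p q} → u ≤ v → v ≈ ⋁ (pair u v)
    ⋁-pair {u = u} {v} u≤v = antisym (⋁-upper (pair u v) (lift true))
      (⋁-least (pair u v) λ { (lift false) → u≤v ; (lift true) → ≤-refl })

  ∘-monoʳ : ∀ {p q r} (v : Hom q r) {u u′ : Hom p q} → u ≤ u′ → v ∘ u ≤ v ∘ u′
  ∘-monoʳ v {u} {u′} l =
      ⋁-upper (λ i → v ∘ pair u u′ i) (lift false)
    ⨾ ≥-reflexive (∘-⋁ˡ v (pair u u′))
    ⨾ ≤-reflexive (∘-cong ≈-refl (≈-sym (⋁-pair l)))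

  ∘-monoˡ : ∀ {p q r} {v v′ : Hom q r} (u : Hom p q) → v ≤ v′ → v ∘ u ≤ v′ ∘ u
  ∘-monoˡ {v = v} {v′} u l =
      ⋁-upper (λ i → pair v v′ i ∘ u) (lift false)
    ⨾ ≥-reflexive (∘-⋁ʳ (pair v v′) u)
    ⨾ ≤-reflexive (∘-cong (≈-sym (⋁-pair l)) ≈-refl)

  ∘-mono : ∀ {p q r} {v v′ : Hom q r} {u u′ : Hom p q} →
           v ≤ v′ → u ≤ u′ → v ∘ u ≤ v′ ∘ u′
  ∘-mono l m = ∘-monoˡ _ l ⨾ ∘-monoʳ _ m

  assoc≤ : ∀ {p q r s} {w : Hom r s} {v : Hom q r} {u : Hom p q} →
           (w ∘ v) ∘ u ≤ w ∘ (v ∘ u)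
  assoc≤ = ≤-reflexive (assoc _ _ _)

  assoc≥ : ∀ {p q r s} {w : Hom r s} {v : Hom q r} {u : Hom p q} →
           w ∘ (v ∘ u) ≤ (w ∘ v) ∘ u
  assoc≥ = ≥-reflexive (assoc _ _ _)

  idˡ≤ : ∀ {p q} {u : Hom p q} → id ∘ u ≤ u
  idˡ≤ = ≤-reflexive (identityˡ _)

  idˡ≥ : ∀ {p q} {u : Hom p q} → u ≤ id ∘ u
  idˡ≥ = ≥-reflexive (identityˡ _)

  idʳ≤ : ∀ {p q} {u : Hom p q} → u ∘ id ≤ u
  idʳ≤ = ≤-reflexive (identityʳ _)

  idʳ≥ : ∀ {p q} {u : Hom p q} → u ≤ u ∘ id
  idʳ≥ = ≥-reflexive (identityʳ _)

  ↙-intro : ∀ {p q r} {w : Hom p r} {u : Hom p q} {v : Hom q r} →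
            v ∘ u ≤ w → v ≤ w ↙ u
  ↙-intro {v = v} l = ⋁-upper proj₁ (v , l)

  ↙-elim : ∀ {p q r} {w : Hom p r} {u : Hom p q} {v : Hom q r} →
           v ≤ w ↙ u → v ∘ u ≤ w
  ↙-elim l = ∘-monoˡ _ l ⨾ ≤-reflexive (∘-⋁ʳ _ _) ⨾ ⋁-least _ proj₂

  ↘-intro : ∀ {p q r} {w : Hom p r} {u : Hom p q} {v : Hom q r} →
            v ∘ u ≤ w → u ≤ v ↘ w
  ↘-intro {u = u} l = ⋁-upper proj₁ (u , l)

  ↘-elim : ∀ {p q r} {w : Hom p r} {u : Hom p q} {v : Hom q r} →
           u ≤ v ↘ w → v ∘ u ≤ w
  ↘-elim l = ∘-monoʳ _ l ⨾ ≤-reflexive (∘-⋁ˡ _ _) ⨾ ⋁-least _ proj₂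

module QCategories {ℓ} (Q : Quantaloid ℓ) where
  open Quantaloid Q
  open QuantaloidProperties Q

  -- A set A₀ with a type map |·| : A₀ → Ob is given by its fibres Obj q (the
  -- elements of type q).  Elements are only compared for equality, or by ≼,
  -- inside one fibre, so the condition |x| = |y| is built in, and so is type
  -- preservation of a Q-functor.  Fibres are setoids, because equality of
  -- presheaves is pointwise equality of arrows.

  record QCat : Set (suc ℓ) where
    infix 4 _≈₀_ _≼_
    field
      ob : Ob → Setoid ℓ ℓ

    Obj : Ob → Set ℓ
    Obj q = Setoid.Carrier (ob q)

    _≈₀_ : ∀ {q} → Obj q → Obj q → Set ℓ
    _≈₀_ {q} = Setoid._≈_ (ob q)

    field
      hom      : ∀ {p q} → Obj p → Obj q → Hom p q
      hom-cong : ∀ {p q} {x x′ : Obj p} {y y′ : Obj q} →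
                 x ≈₀ x′ → y ≈₀ y′ → hom x y ≈ hom x′ y′
      hom-id   : ∀ {p} (x : Obj p) → id ≤ hom x x
      hom-∘    : ∀ {p q r} (x : Obj p) (y : Obj q) (z : Obj r) →
                 hom y z ∘ hom x y ≤ hom x z

    _≼_ : ∀ {q} → Obj q → Obj q → Set ℓ
    x ≼ y = id ≤ hom x y

    Total : Set ℓ
    Total = Σ[ q ∈ Ob ] Obj q

    module Fibre {q} = Setoid (ob q)

    ≼-reflexive : ∀ {q} {x y : Obj q} → x ≈₀ y → x ≼ y
    ≼-reflexive {x = x} e = hom-id x ⨾ ≤-reflexive (hom-cong Fibre.refl e)

    ≼-trans : ∀ {q} {x y z : Obj q} → x ≼ y → y ≼ z → x ≼ z
    ≼-trans l m = idˡ≥ ⨾ ∘-mono m l ⨾ hom-∘ _ _ _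

  open QCat public using (Obj; hom)

  Separated : QCat → Set ℓ
  Separated A = ∀ {q} (x y : Obj A q) → x ≼ y → y ≼ x → x ≈₀ y
    where open QCat A using (_≼_; _≈₀_)

  record Subset (A : QCat) : Set (suc ℓ) where
    open QCat A using (_≈₀_)
    field
      Mem  : ∀ {q} → Obj A q → Set ℓ
      resp : ∀ {q} {x y : Obj A q} → x ≈₀ y → Mem x → Mem y

  infix 4 _∈_ _≐_

  _∈_ : ∀ {A q} → Obj A q → Subset A → Set ℓ
  x ∈ S = Subset.Mem S x

  _≐_ : ∀ {A} → Subset A → Subset A → Set ℓ
  _≐_ {A} S T = ∀ {q} (x : Obj A q) → (x ∈ S) ⇔ (x ∈ T)

  infix 6 _∣_

  _∣_ : (A : QCat) → Subset A → QCat
  A ∣ S = record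
    { ob       = λ q → record
        { Carrier       = Σ[ x ∈ Obj A q ] x ∈ S
        ; _≈_           = λ x y → proj₁ x ≈₀ proj₁ y
        ; isEquivalence = record
            { refl = Fibre.refl ; sym = Fibre.sym ; trans = Fibre.trans } }
    ; hom      = λ x y → hom A (proj₁ x) (proj₁ y)
    ; hom-cong = hom-cong
    ; hom-id   = λ x → hom-id (proj₁ x)
    ; hom-∘    = λ x y z → hom-∘ (proj₁ x) (proj₁ y) (proj₁ z)
    } where open QCat A hiding (Obj; hom)

  -- For QFunctor and Dist, eta is off and the constructors are inlined to
  -- copattern clauses, so that conversion checking does not unfold proofs.
  record QFunctor (A B : QCat) : Set ℓ where
    no-eta-equality
    constructor mkFunctor
    private
      module A = QCat A
      module B = QCat B
    field
      map  : ∀ {q} → Obj A q → Obj B q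
      cong : ∀ {q} {x y : Obj A q} → x A.≈₀ y → map x B.≈₀ map y
      mono : ∀ {p q} (x : Obj A p) (y : Obj A q) →
             hom A x y ≤ hom B (map x) (map y)

    map-≼ : ∀ {q} {x y : Obj A q} → x A.≼ y → map x B.≼ map y
    map-≼ l = l ⨾ mono _ _

  {-# INLINE mkFunctor #-}

  infixl 20 _·_

  _·_ : ∀ {A B q} → QFunctor A B → Obj A q → Obj B q
  F · x = QFunctor.map F x

  infix 4 _≈Q_ _≤Q_

  _≈Q_ : ∀ {A B} → QFunctor A B → QFunctor A B → Set ℓ
  _≈Q_ {A} {B} F G = ∀ {q} (x : Obj A q) → QCat._≈₀_ B (F · x) (G · x)

  _≤Q_ : ∀ {A B} → QFunctor A B → QFunctor A B → Set ℓ
  _≤Q_ {A} {B} F G = ∀ {q} (x : Obj A q) → QCat._≼_ B (F · x) (G · x)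

  idQ : ∀ {A} → QFunctor A A
  idQ = record { map = λ x → x ; cong = λ e → e ; mono = λ _ _ → ≤-refl }

  infixr 9 _∘Q_

  _∘Q_ : ∀ {A B C} → QFunctor B C → QFunctor A B → QFunctor A C
  G ∘Q F = record
    { map  = λ x → G · (F · x)
    ; cong = λ e → QFunctor.cong G (QFunctor.cong F e)
    ; mono = λ x y → QFunctor.mono F x y ⨾ QFunctor.mono G _ _
    }

  record IsLeftAdjoint {A B : QCat} (F : QFunctor A B) : Set ℓ where
    field
      right  : QFunctor B A
      unit   : idQ ≤Q right ∘Q F
      counit : F ∘Q right ≤Q idQ

  record Dist (A B : QCat) : Set ℓ where
    no-eta-equality
    constructor mkDist
    field
      app : ∀ {p q} → Obj A p → Obj B q → Hom p q
      act : ∀ {p p′ q q′} (x′ : Obj A p′) (x : Obj A p) (y : Obj B q) (y′ : Obj B q′) →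
            hom B y y′ ∘ app x y ∘ hom A x′ x ≤ app x′ y′

    actʳ : ∀ {p p′ q} (x′ : Obj A p′) (x : Obj A p) (y : Obj B q) →
           app x y ∘ hom A x′ x ≤ app x′ y
    actʳ x′ x y = idˡ≥ ⨾ ∘-monoˡ _ (QCat.hom-id B y) ⨾ act x′ x y y

    actˡ : ∀ {p q q′} (x : Obj A p) (y : Obj B q) (y′ : Obj B q′) →
           hom B y y′ ∘ app x y ≤ app x y′
    actˡ x y y′ = ∘-monoʳ _ (idʳ≥ ⨾ ∘-monoʳ _ (QCat.hom-id A x)) ⨾ act x x y y′

    app-congˡ : ∀ {p q} {x x′ : Obj A p} (y : Obj B q) →
                QCat._≈₀_ A x x′ → app x y ≈ app x′ y
    app-congˡ y e = antisym (half (QCat.Fibre.sym A e)) (half e)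
      where
      half : ∀ {p} {x x′ : Obj A p} → QCat._≈₀_ A x x′ → app x′ y ≤ app x y
      half e = idʳ≥ ⨾ ∘-monoʳ _ (QCat.≼-reflexive A e) ⨾ actʳ _ _ y

    app-congʳ : ∀ {p q} (x : Obj A p) {y y′ : Obj B q} →
                QCat._≈₀_ B y y′ → app x y ≈ app x y′
    app-congʳ x e = antisym (half e) (half (QCat.Fibre.sym B e))
      where
      half : ∀ {q} {y y′ : Obj B q} → QCat._≈₀_ B y y′ → app x y ≤ app x y′
      half e = idˡ≥ ⨾ ∘-monoˡ _ (QCat.≼-reflexive B e) ⨾ actˡ x _ _

  {-# INLINE mkDist #-}

  open Dist public using (app)

  private
    act-from : ∀ {A B : QCat} (f : ∀ {p q} → Obj A p → Obj B q → Hom p q) →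
               (∀ {p p′ q} (x′ : Obj A p′) (x : Obj A p) (y : Obj B q) →
                  f x y ∘ hom A x′ x ≤ f x′ y) →
               (∀ {p q q′} (x : Obj A p) (y : Obj B q) (y′ : Obj B q′) →
                  hom B y y′ ∘ f x y ≤ f x y′) →
               ∀ {p p′ q q′} (x′ : Obj A p′) (x : Obj A p) (y : Obj B q) (y′ : Obj B q′) →
               hom B y y′ ∘ f x y ∘ hom A x′ x ≤ f x′ y′
    act-from f r l x′ x y y′ = ∘-monoʳ _ (r x′ x y) ⨾ l x′ y y′

  infix 4 _≈ᴰ_

  record _≈ᴰ_ {A B : QCat} (φ ψ : Dist A B) : Set ℓ where
    constructor mk≈
    field
      at : ∀ {p q} (x : Obj A p) (y : Obj B q) → app φ x y ≈ app ψ x y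

  open _≈ᴰ_ public

  idᴰ : ∀ A → Dist A A
  idᴰ A = record
    { app = hom A
    ; act = act-from {A} {A} (hom A) (λ x′ x y → QCat.hom-∘ A x′ x y) (QCat.hom-∘ A)
    }

  infixr 9 _∘ᴰ_
  infix  8 _↙ᴰ_ _↘ᴰ_

  _∘ᴰ_ : ∀ {A B C} → Dist B C → Dist A B → Dist A C
  _∘ᴰ_ {A} {B} {C} ψ φ = record
    { app = f
    ; act = act-from {A} {C} f
        (λ x′ x z → ≤-reflexive (∘-⋁ʳ _ _) ⨾ ⋁-least _ λ { (_ , y) →
             assoc≤ ⨾ ∘-monoʳ _ (Dist.actʳ φ x′ x y) ⨾ ⋁-upper _ (_ , y) })
        (λ x z z′ → ≤-reflexive (∘-⋁ˡ _ _) ⨾ ⋁-least _ λ { (_ , y) →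
             assoc≥ ⨾ ∘-monoˡ _ (Dist.actˡ ψ y z z′) ⨾ ⋁-upper _ (_ , y) })
    }
    where
    f : ∀ {p r} → Obj A p → Obj C r → Hom p r
    f x z = ⋁ {I = QCat.Total B} λ (_ , y) → app ψ y z ∘ app φ x y

  _↙ᴰ_ : ∀ {A B C} → Dist A C → Dist A B → Dist B C
  _↙ᴰ_ {A} {B} {C} ξ φ = record
    { app = f
    ; act = act-from {B} {C} f
        (λ y′ y z → ⋀-greatest _ λ { (_ , x) → ↙-intro
             (assoc≤ ⨾ ∘-mono (⋀-lower _ (_ , x)) (Dist.actˡ φ x y′ y)
               ⨾ ↙-elim ≤-refl) })
        (λ y z z′ → ⋀-greatest _ λ { (_ , x) → ↙-intro
             (assoc≤ ⨾ ∘-monoʳ _ (∘-monoˡ _ (⋀-lower _ (_ , x)) ⨾ ↙-elim ≤-refl)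
               ⨾ Dist.actˡ ξ x z z′) })
    }
    where
    f : ∀ {q r} → Obj B q → Obj C r → Hom q r
    f y z = ⋀ {I = QCat.Total A} λ (_ , x) → app ξ x z ↙ app φ x y

  _↘ᴰ_ : ∀ {A B C} → Dist B C → Dist A C → Dist A B
  _↘ᴰ_ {A} {B} {C} ψ ξ = record
    { app = f
    ; act = act-from {A} {B} f
        (λ x′ x y → ⋀-greatest _ λ { (_ , z) → ↘-intro
             (assoc≥ ⨾ ∘-monoˡ _ (∘-monoʳ _ (⋀-lower _ (_ , z)) ⨾ ↘-elim ≤-refl)
               ⨾ Dist.actʳ ξ x′ x z) })
        (λ x y y′ → ⋀-greatest _ λ { (_ , z) → ↘-intro
             (assoc≥ ⨾ ∘-mono (Dist.actʳ ψ y y′ z) (⋀-lower _ (_ , z))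
               ⨾ ↘-elim ≤-refl) })
    }
    where
    f : ∀ {p q} → Obj A p → Obj B q → Hom p q
    f x y = ⋀ {I = QCat.Total C} λ (_ , z) → app ψ y z ↘ app ξ x z

  infix 30 _♮ ♮_

  -- F ♮ is the graph F_♮ and ♮ F is the cograph F^♮.
  _♮ : ∀ {A B} → QFunctor A B → Dist A B
  _♮ {A} {B} F = record
    { app = λ x y → hom B (F · x) y
    ; act = act-from {A} {B} (λ x y → hom B (F · x) y)
        (λ x′ x y → ∘-monoʳ _ (QFunctor.mono F x′ x) ⨾ QCat.hom-∘ B _ _ _)
        (λ x y y′ → QCat.hom-∘ B _ _ _)
    }

  ♮_ : ∀ {A B} → QFunctor A B → Dist B A
  ♮_ {A} {B} F = record
    { app = λ y x → hom B y (F · x)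
    ; act = act-from {B} {A} (λ y x → hom B y (F · x))
        (λ y′ y x → QCat.hom-∘ B _ _ _)
        (λ y x x′ → ∘-monoˡ _ (QFunctor.mono F x x′) ⨾ QCat.hom-∘ B _ _ _)
    }

  -- The family of fibres of the set with a single element ∗, of type q.
  data One (q : Ob) : Ob → Set ℓ where
    ∗ : One q q

  ｛_｝ : Ob → QCat
  ｛ q ｝ = record
    { ob       = λ p → ≡.setoid (One q p)
    ; hom      = h
    ; hom-cong = λ { ≡.refl ≡.refl → ≈-refl }
    ; hom-id   = λ { ∗ → ≤-refl }
    ; hom-∘    = λ { ∗ ∗ ∗ → idˡ≤ }
    }
    where
    h : ∀ {p r} → One q p → One q r → Hom p r
    h ∗ ∗ = id

  -- A Q-arrow viewed as a distributor between one-object Q-categories.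
  ⌜_⌝ : ∀ {p q} → Hom p q → Dist ｛ p ｝ ｛ q ｝
  ⌜_⌝ {p} {q} u = record
    { app = f
    ; act = λ { ∗ ∗ ∗ ∗ → idˡ≤ ⨾ idʳ≤ }
    }
    where
    f : ∀ {p′ q′} → One p p′ → One q q′ → Hom p′ q′
    f ∗ ∗ = u

  ≈ᴰ-sym : ∀ {A B} {φ ψ : Dist A B} → φ ≈ᴰ ψ → ψ ≈ᴰ φ
  ≈ᴰ-sym e = mk≈ λ x y → ≈-sym (at e x y)

  DistSetoid : QCat → QCat → Setoid ℓ ℓ
  DistSetoid A B = record
    { Carrier       = Dist A B
    ; _≈_           = _≈ᴰ_
    ; isEquivalence = record
        { refl  = mk≈ λ _ _ → ≈-refl
        ; sym   = ≈ᴰ-sym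
        ; trans = λ e f → mk≈ λ x y → ≈-trans (at e x y) (at f x y) }
    }

  P : QCat → QCat
  P A = record
    { ob       = λ q → DistSetoid A ｛ q ｝
    ; hom      = λ μ μ′ → app (μ′ ↙ᴰ μ) ∗ ∗
    ; hom-cong = λ e f → antisym (half e f) (half (≈ᴰ-sym e) (≈ᴰ-sym f))
    ; hom-id   = λ μ → ⋀-greatest _ λ { (_ , x) → ↙-intro idˡ≤ }
    ; hom-∘    = λ μ μ′ μ″ → ⋀-greatest _ λ { (_ , x) → ↙-intro
        (assoc≤ ⨾ ∘-mono (⋀-lower _ (_ , x)) (∘-monoˡ _ (⋀-lower _ (_ , x)) ⨾ ↙-elim ≤-refl)
          ⨾ ↙-elim ≤-refl) }
    }
    where
    half : ∀ {p q} {μ ν : Dist A ｛ p ｝} {μ′ ν′ : Dist A ｛ q ｝} → μ ≈ᴰ ν → μ′ ≈ᴰ ν′ →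
           app (μ′ ↙ᴰ μ) ∗ ∗ ≤ app (ν′ ↙ᴰ ν) ∗ ∗
    half e f = ⋀-greatest _ λ { (_ , x) → ↙-intro
      (∘-mono (⋀-lower _ (_ , x)) (≥-reflexive (at e x ∗)) ⨾ ↙-elim ≤-refl
        ⨾ ≤-reflexive (at f x ∗)) }

  P† : QCat → QCat
  P† A = record
    { ob       = λ q → DistSetoid ｛ q ｝ A
    ; hom      = λ ν ν′ → app (ν′ ↘ᴰ ν) ∗ ∗
    ; hom-cong = λ e f → antisym (half e f) (half (≈ᴰ-sym e) (≈ᴰ-sym f))
    ; hom-id   = λ ν → ⋀-greatest _ λ { (_ , x) → ↘-intro idʳ≤ }
    ; hom-∘    = λ ν ν′ ν″ → ⋀-greatest _ λ { (_ , x) → ↘-intro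
        (assoc≥ ⨾ ∘-mono (∘-monoʳ _ (⋀-lower _ (_ , x)) ⨾ ↘-elim ≤-refl) (⋀-lower _ (_ , x))
          ⨾ ↘-elim ≤-refl) }
    }
    where
    half : ∀ {p q} {μ ν : Dist ｛ p ｝ A} {μ′ ν′ : Dist ｛ q ｝ A} → μ ≈ᴰ ν → μ′ ≈ᴰ ν′ →
           app (μ′ ↘ᴰ μ) ∗ ∗ ≤ app (ν′ ↘ᴰ ν) ∗ ∗
    half e f = ⋀-greatest _ λ { (_ , x) → ↘-intro
      (∘-mono (≥-reflexive (at f ∗ x)) (⋀-lower _ (_ , x)) ⨾ ↘-elim ≤-refl
        ⨾ ≤-reflexive (at e ∗ x)) }

  record HasSup {A : QCat} {q} (μ : Obj (P A) q) : Set ℓ where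
    field
      sup    : Obj A q
      is-sup : ∀ {p} (y : Obj A p) → hom A sup y ≈ app (idᴰ A ↙ᴰ μ) ∗ y

  Complete : QCat → Set ℓ
  Complete A = ∀ {q} (μ : Obj (P A) q) → HasSup μ

  module _ {A : QCat} where

    infix 4 _⊑_

    record _⊑_ {q} (μ ν : Obj (P A) q) : Set ℓ where
      constructor mk⊑
      field
        le : ∀ {p} (x : Obj A p) → app μ x ∗ ≤ app ν x ∗

    open _⊑_ public

    P-intro : ∀ {q r} (μ : Obj (P A) q) (ν : Obj (P A) r) {u : Hom q r} →
              (∀ {p} (x : Obj A p) → u ∘ app μ x ∗ ≤ app ν x ∗) → u ≤ hom (P A) μ ν
    P-intro μ ν l = ⋀-greatest _ λ { (_ , x) → ↙-intro (l x) }

    P-elim : ∀ {q r} (μ : Obj (P A) q) (ν : Obj (P A) r) {u : Hom q r} →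
             u ≤ hom (P A) μ ν → ∀ {p} (x : Obj A p) → u ∘ app μ x ∗ ≤ app ν x ∗
    P-elim μ ν l x = ↙-elim (l ⨾ ⋀-lower _ (_ , x))

    ⊑⇒≼ : ∀ {q} {μ ν : Obj (P A) q} → μ ⊑ ν → QCat._≼_ (P A) μ ν
    ⊑⇒≼ {_} {μ} {ν} l = P-intro μ ν λ x → idˡ≤ ⨾ le l x

    ≼⇒⊑ : ∀ {q} (μ ν : Obj (P A) q) → QCat._≼_ (P A) μ ν → μ ⊑ ν
    ≼⇒⊑ μ ν l = mk⊑ λ x → idˡ≥ ⨾ P-elim μ ν l x

    ⊑-refl : ∀ {q} {μ : Obj (P A) q} → μ ⊑ μ
    ⊑-refl = mk⊑ λ x → ≤-refl

    ⊑-trans : ∀ {q} {μ ν ξ : Obj (P A) q} → μ ⊑ ν → ν ⊑ ξ → μ ⊑ ξ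
    ⊑-trans l m = mk⊑ λ x → le l x ⨾ le m x

    ⊑-antisym : ∀ {q} {μ ν : Obj (P A) q} → μ ⊑ ν → ν ⊑ μ → μ ≈ᴰ ν
    ⊑-antisym l m = mk≈ λ { x ∗ → antisym (le l x) (le m x) }

    ≈⇒⊑ : ∀ {q} {μ ν : Obj (P A) q} → μ ≈ᴰ ν → μ ⊑ ν
    ≈⇒⊑ e = mk⊑ λ x → ≤-reflexive (at e x ∗)

    ≈⇒⊒ : ∀ {q} {μ ν : Obj (P A) q} → μ ≈ᴰ ν → ν ⊑ μ
    ≈⇒⊒ e = ≈⇒⊑ (≈ᴰ-sym e)

    P-separated : Separated (P A)
    P-separated μ ν l m = ⊑-antisym (≼⇒⊑ μ ν l) (≼⇒⊑ ν μ m)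

  -- φ ⁎ is φ_*.
  infix 30 _↑ _↓ _^* _⁎

  _↑ : ∀ {A B} → Dist A B → QFunctor (P A) (P† B)
  _↑ {A} {B} φ = record
    { map  = λ μ → φ ↙ᴰ μ
    ; cong = λ e → mk≈ λ { ∗ y → antisym (half (≈⇒⊒ e) y) (half (≈⇒⊑ e) y) }
    ; mono = λ μ μ′ → ⋀-greatest _ λ { (_ , y) → ↘-intro (⋀-greatest _ λ { (_ , x) → ↙-intro
        (assoc≤ ⨾ ∘-mono (⋀-lower _ (_ , x)) (P-elim μ μ′ ≤-refl x) ⨾ ↙-elim ≤-refl) }) }
    }
    where
    half : ∀ {q} {μ ν : Obj (P A) q} → ν ⊑ μ →
           ∀ {p} (y : Obj B p) → app (φ ↙ᴰ μ) ∗ y ≤ app (φ ↙ᴰ ν) ∗ y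
    half l y = ⋀-greatest _ λ { (_ , x) → ↙-intro
      (∘-mono (⋀-lower _ (_ , x)) (le l x) ⨾ ↙-elim ≤-refl) }

  _↓ : ∀ {A B} → Dist A B → QFunctor (P† B) (P A)
  _↓ {A} {B} φ = record
    { map  = λ ν → ν ↘ᴰ φ
    ; cong = λ e → ⊑-antisym (half (≈ᴰ-sym e)) (half e)
    ; mono = λ ν ν′ → P-intro (ν ↘ᴰ φ) (ν′ ↘ᴰ φ) λ x → ⋀-greatest _ λ { (_ , y) → ↘-intro
        (assoc≥ ⨾ ∘-mono (∘-monoʳ _ (⋀-lower _ (_ , y)) ⨾ ↘-elim ≤-refl) (⋀-lower _ (_ , y))
          ⨾ ↘-elim ≤-refl) }
    }
    where
    half : ∀ {q} {μ ν : Obj (P† B) q} → ν ≈ᴰ μ → (μ ↘ᴰ φ) ⊑ (ν ↘ᴰ φ)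
    half e = mk⊑ λ x → ⋀-greatest _ λ { (_ , y) → ↘-intro
      (∘-mono (≤-reflexive (at e ∗ y)) (⋀-lower _ (_ , y)) ⨾ ↘-elim ≤-refl) }

  _^* : ∀ {A B} → Dist A B → QFunctor (P B) (P A)
  _^* {A} {B} φ = record
    { map  = λ ν → ν ∘ᴰ φ
    ; cong = λ e → ⊑-antisym (half e) (half (≈ᴰ-sym e))
    ; mono = λ ν ν′ → P-intro (ν ∘ᴰ φ) (ν′ ∘ᴰ φ) λ x →
        ≤-reflexive (∘-⋁ˡ _ _) ⨾ ⋁-least _ λ { (_ , y) →
          assoc≥ ⨾ ∘-monoˡ _ (P-elim ν ν′ ≤-refl y) ⨾ ⋁-upper _ (_ , y) }
    }
    where
    half : ∀ {q} {μ ν : Obj (P B) q} → μ ≈ᴰ ν → (μ ∘ᴰ φ) ⊑ (ν ∘ᴰ φ)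
    half e = mk⊑ λ x → ⋁-least _ λ { (_ , y) →
      ∘-monoˡ _ (≤-reflexive (at e y ∗)) ⨾ ⋁-upper _ (_ , y) }

  _⁎ : ∀ {A B} → Dist A B → QFunctor (P A) (P B)
  _⁎ {A} {B} φ = record
    { map  = λ μ → μ ↙ᴰ φ
    ; cong = λ e → ⊑-antisym (half e) (half (≈ᴰ-sym e))
    ; mono = λ μ μ′ → P-intro (μ ↙ᴰ φ) (μ′ ↙ᴰ φ) λ y → ⋀-greatest _ λ { (_ , x) → ↙-intro
        (assoc≤ ⨾ ∘-monoʳ _ (∘-monoˡ _ (⋀-lower _ (_ , x)) ⨾ ↙-elim ≤-refl)
          ⨾ P-elim μ μ′ ≤-refl x) }
    }
    where
    half : ∀ {q} {μ ν : Obj (P A) q} → μ ≈ᴰ ν → (μ ↙ᴰ φ) ⊑ (ν ↙ᴰ φ)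
    half e = mk⊑ λ y → ⋀-greatest _ λ { (_ , x) → ↙-intro
      (∘-monoˡ _ (⋀-lower _ (_ , x)) ⨾ ↙-elim ≤-refl ⨾ ≤-reflexive (at e x ∗)) }

  Fix : ∀ {A} → QFunctor A A → Subset A
  Fix {A} c = record
    { Mem  = λ x → c · x ≈₀ x
    ; resp = λ e m → Fibre.trans (QFunctor.cong c (Fibre.sym e)) (Fibre.trans m e)
    } where open QCat A using (_≈₀_; module Fibre)

  M₀ : ∀ {A B} → Dist A B → Subset (P A)
  M₀ φ = Fix (φ ↓ ∘Q φ ↑)

  K₀ : ∀ {A B} → Dist A B → Subset (P B)
  K₀ φ = Fix (φ ⁎ ∘Q φ ^*)

  -- The copresheaf A(a,-).
  corep : ∀ A {p} → Obj A p → Obj (P† A) p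
  corep A {p} a = record { app = f ; act = λ { ∗ ∗ y y′ →
      ∘-monoʳ _ idʳ≤ ⨾ QCat.hom-∘ A a y y′ } }
    where
    f : ∀ {p′ q} → One p p′ → Obj A q → Hom p′ q
    f ∗ x = hom A a x

  BarSubset : ∀ A → Subset (P A)
  BarSubset A = record
    { Mem  = λ {q} μ → Σ[ p ∈ Ob ] Σ[ a ∈ Obj A p ] Σ[ u ∈ Hom p q ] μ ≈ᴰ ⌜ u ⌝ ↙ᴰ corep A a
    ; resp = λ { e (p , a , u , m) → p , a , u , Setoid.trans (DistSetoid _ _) (≈ᴰ-sym e) m }
    }

  Bar : QCat → QCat
  Bar A = P A ∣ BarSubset A

  -- For S = BarSubset A this is A^▷.
  evalOn : ∀ {A} (S : Subset (P A)) → Dist A (P A ∣ S)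
  evalOn S = record
    { app = λ a μ → app (proj₁ μ) a ∗
    ; act = λ x′ x (μ , _) (μ′ , _) →
        ∘-monoʳ _ (Dist.actʳ μ x′ x ∗) ⨾ P-elim μ μ′ ≤-refl x′
    }

  infix 30 _^▷

  _^▷ : ∀ {A B} → Dist A B → Dist B (Bar A)
  _^▷ {A} φ = evalOn (BarSubset A) ↙ᴰ φ

  record SupObj : Set (suc ℓ) where
    field
      cat       : QCat
      separated : Separated cat
      complete  : Complete cat

  open SupObj public using (cat)

  record LeftAdjoint (A B : QCat) : Set ℓ where
    field
      fun           : QFunctor A B
      isLeftAdjoint : IsLeftAdjoint fun

  open LeftAdjoint public using (fun)

  isLeftAdjoint-id : ∀ {A} → IsLeftAdjoint (idQ {A})
  isLeftAdjoint-id {A} = record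
    { right = idQ ; unit = QCat.hom-id A ; counit = QCat.hom-id A }

  isLeftAdjoint-∘ : ∀ {A B C} {G : QFunctor B C} {F : QFunctor A B} →
                    IsLeftAdjoint G → IsLeftAdjoint F → IsLeftAdjoint (G ∘Q F)
  isLeftAdjoint-∘ {A} {B} {C} {G} {F} l m = record
    { right  = F.right ∘Q G.right
    ; unit   = λ x → QCat.≼-trans A (F.unit x) (QFunctor.map-≼ F.right (G.unit (F · x)))
    ; counit = λ z → QCat.≼-trans C (QFunctor.map-≼ G (F.counit (G.right · z))) (G.counit z)
    }
    where
    module G = IsLeftAdjoint l
    module F = IsLeftAdjoint m

  ∘Q-cong : ∀ {A B C} {G G′ : QFunctor B C} {F F′ : QFunctor A B} →
            G ≈Q G′ → F ≈Q F′ → G ∘Q F ≈Q G′ ∘Q F′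
  ∘Q-cong {C = C} {G} e f x = QCat.Fibre.trans C (QFunctor.cong G (f x)) (e _)

  Sup : Category (suc ℓ) ℓ ℓ
  Sup = record
    { Obj       = SupObj
    ; Hom       = λ X Y → LeftAdjoint (cat X) (cat Y)
    ; _≈_       = λ F G → fun F ≈Q fun G
    ; equiv     = λ {X} {Y} → record
        { refl  = λ x → QCat.Fibre.refl (cat Y)
        ; sym   = λ e x → QCat.Fibre.sym (cat Y) (e x)
        ; trans = λ e f x → QCat.Fibre.trans (cat Y) (e x) (f x) }
    ; id        = record { fun = idQ ; isLeftAdjoint = isLeftAdjoint-id }
    ; _∘_       = λ G F → record
        { fun = fun G ∘Q fun F
        ; isLeftAdjoint = isLeftAdjoint-∘
            (LeftAdjoint.isLeftAdjoint G) (LeftAdjoint.isLeftAdjoint F) }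
    ; ∘-cong    = λ {X} {Y} {Z} {G} {G′} {F} {F′} e f →
        ∘Q-cong {G = fun G} {fun G′} {fun F} {fun F′} e f
    ; assoc     = λ {W} {X} {Y} {Z} _ _ _ x → QCat.Fibre.refl (cat Z)
    ; identityˡ = λ {X} {Y} _ x → QCat.Fibre.refl (cat Y)
    ; identityʳ = λ {X} {Y} _ x → QCat.Fibre.refl (cat Y)
    }

  record ChuObj : Set (suc ℓ) where
    constructor chu
    field
      {dom cod} : QCat
      dist      : Dist dom cod

  open ChuObj public using (dom; cod; dist)

  record ChuTransform (Φ Ψ : ChuObj) : Set ℓ where
    field
      F      : QFunctor (dom Φ) (dom Ψ)
      G      : QFunctor (cod Ψ) (cod Φ)
      app-FG : ∀ {p q} (a : Obj (dom Φ) p) (b : Obj (cod Ψ) q) →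
               app (dist Ψ) (F · a) b ≈ app (dist Φ) a (G · b)

  Chu : Category (suc ℓ) ℓ ℓ
  Chu = record
    { Obj       = ChuObj
    ; Hom       = ChuTransform
    ; _≈_       = λ f g → (F f ≈Q F g) × (G f ≈Q G g)
    ; equiv     = λ {Φ} {Ψ} → record
        { refl  = (λ _ → QCat.Fibre.refl (dom Ψ)) , (λ _ → QCat.Fibre.refl (cod Φ))
        ; sym   = λ (d , e) →
            (λ x → QCat.Fibre.sym (dom Ψ) (d x)) , (λ y → QCat.Fibre.sym (cod Φ) (e y))
        ; trans = λ (d , e) (d′ , e′) →
            (λ x → QCat.Fibre.trans (dom Ψ) (d x) (d′ x)) ,
            (λ y → QCat.Fibre.trans (cod Φ) (e y) (e′ y)) }
    ; id        = record { F = idQ ; G = idQ ; app-FG = λ _ _ → ≈-refl }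
    ; _∘_       = λ g f → record
        { F      = F g ∘Q F f
        ; G      = G f ∘Q G g
        ; app-FG = λ a b → ≈-trans (app-FG g (F f · a) b) (app-FG f a (G g · b)) }
    ; ∘-cong    = λ {_} {_} {_} {g} {g′} {f} {f′} (d , e) (d′ , e′) →
        ∘Q-cong {G = F g} {F g′} {F f} {F f′} d d′ ,
        ∘Q-cong {G = G f} {G f′} {G g} {G g′} e′ e
    ; assoc     = λ {W} {_} {_} {Z} _ _ _ →
        (λ _ → QCat.Fibre.refl (dom Z)) , (λ _ → QCat.Fibre.refl (cod W))
    ; identityˡ = λ {X} {Y} _ →
        (λ _ → QCat.Fibre.refl (dom Y)) , (λ _ → QCat.Fibre.refl (cod X))
    ; identityʳ = λ {X} {Y} _ →
        (λ _ → QCat.Fibre.refl (dom Y)) , (λ _ → QCat.Fibre.refl (cod X))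
    } where open ChuTransform

  ↙ᴰ-intro : ∀ {A B C} (ξ : Dist A C) (φ : Dist A B) {q r} {y : Obj B q} {z : Obj C r}
             {v : Hom q r} →
             (∀ {p} (x : Obj A p) → v ∘ app φ x y ≤ app ξ x z) → v ≤ app (ξ ↙ᴰ φ) y z
  ↙ᴰ-intro ξ φ l = ⋀-greatest _ λ { (_ , x) → ↙-intro (l x) }

  ↙ᴰ-elim : ∀ {A B C} (ξ : Dist A C) (φ : Dist A B) {p q r}
            (x : Obj A p) {y : Obj B q} {z : Obj C r} →
            app (ξ ↙ᴰ φ) y z ∘ app φ x y ≤ app ξ x z
  ↙ᴰ-elim ξ φ x = ↙-elim (⋀-lower _ (_ , x))

  ↘ᴰ-intro : ∀ {A B C} (ψ : Dist B C) (ξ : Dist A C) {p q} {x : Obj A p} {y : Obj B q}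
             {u : Hom p q} →
             (∀ {r} (z : Obj C r) → app ψ y z ∘ u ≤ app ξ x z) → u ≤ app (ψ ↘ᴰ ξ) x y
  ↘ᴰ-intro ψ ξ l = ⋀-greatest _ λ { (_ , z) → ↘-intro (l z) }

  ↘ᴰ-elim : ∀ {A B C} (ψ : Dist B C) (ξ : Dist A C) {p q r}
            {x : Obj A p} {y : Obj B q} (z : Obj C r) →
            app ψ y z ∘ app (ψ ↘ᴰ ξ) x y ≤ app ξ x z
  ↘ᴰ-elim ψ ξ z = ↘-elim (⋀-lower _ (_ , z))

  ∘ᴰ-upper : ∀ {A B C} (ψ : Dist B C) (φ : Dist A B) {p q r}
             {x : Obj A p} (y : Obj B q) {z : Obj C r} →
             app ψ y z ∘ app φ x y ≤ app (ψ ∘ᴰ φ) x z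
  ∘ᴰ-upper ψ φ y = ⋁-upper _ (_ , y)

  ∘ᴰ-least : ∀ {A B C} (ψ : Dist B C) (φ : Dist A B) {p r}
             {x : Obj A p} {z : Obj C r} {w : Hom p r} →
             (∀ {q} (y : Obj B q) → app ψ y z ∘ app φ x y ≤ w) → app (ψ ∘ᴰ φ) x z ≤ w
  ∘ᴰ-least ψ φ l = ⋁-least _ λ { (_ , y) → l y }

  ♮⁎-id : ∀ {A q} (μ : Obj (P A) q) → (idQ ♮) ⁎ · μ ≈ᴰ μ
  ♮⁎-id {A} μ = ⊑-antisym
    (mk⊑ λ y → idʳ≥ ⨾ ∘-monoʳ _ (QCat.hom-id A y) ⨾ ↙ᴰ-elim μ (idQ ♮) y)
    (mk⊑ λ y → ↙ᴰ-intro μ (idQ ♮) λ x → Dist.actʳ μ x y ∗)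

  ♮⁎-∘ : ∀ {A B C} (G : QFunctor B C) (F : QFunctor A B) {q} (μ : Obj (P A) q) →
         ((G ∘Q F) ♮) ⁎ · μ ≈ᴰ (G ♮) ⁎ · ((F ♮) ⁎ · μ)
  ♮⁎-∘ {A} {B} {C} G F μ = ⊑-antisym
    (mk⊑ λ z → ↙ᴰ-intro (μ ↙ᴰ F ♮) (G ♮) λ y → ↙ᴰ-intro μ (F ♮) λ x →
        assoc≤ ⨾ ∘-monoʳ _ (∘-monoʳ _ (QFunctor.mono G _ _) ⨾ QCat.hom-∘ C _ _ _)
      ⨾ ↙ᴰ-elim μ ((G ∘Q F) ♮) x)
    (mk⊑ λ z → ↙ᴰ-intro μ ((G ∘Q F) ♮) λ x →
        idʳ≥ ⨾ ∘-mono (↙ᴰ-elim (μ ↙ᴰ F ♮) (G ♮) (F · x)) (QCat.hom-id B (F · x))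
      ⨾ ↙ᴰ-elim μ (F ♮) x)

  ♮⁎-cong : ∀ {A B} {F F′ : QFunctor A B} → F ≈Q F′ → ∀ {q} (μ : Obj (P A) q) →
            (F ♮) ⁎ · μ ≈ᴰ (F′ ♮) ⁎ · μ
  ♮⁎-cong {A} {B} {F} {F′} e μ = ⊑-antisym
      (half {F} {F′} e) (half {F′} {F} λ x → QCat.Fibre.sym B (e x))
    where
    half : ∀ {F F′ : QFunctor A B} → F ≈Q F′ → ((F ♮) ⁎ · μ) ⊑ ((F′ ♮) ⁎ · μ)
    half {F} {F′} e = mk⊑ λ y → ↙ᴰ-intro μ (F′ ♮) λ x →
        ∘-monoʳ _ (≥-reflexive (QCat.hom-cong B (e x) (QCat.Fibre.refl B)))
      ⨾ ↙ᴰ-elim μ (F ♮) x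

  -- The restriction of (F_♮)_* to a Q-functor between the subcategories Bar.
  bar : ∀ {A A′} → QFunctor A A′ → QFunctor (Bar A) (Bar A′)
  bar {A} {A′} F = record
    { map  = λ { (μ , p , a , u , e) → (F ♮) ⁎ · μ , p , F · a , u , member a u e }
    ; cong = QFunctor.cong ((F ♮) ⁎)
    ; mono = λ (μ , _) (μ′ , _) → QFunctor.mono ((F ♮) ⁎) μ μ′
    }
    where
    module A′ = QCat A′
    member : ∀ {p q} {μ : Obj (P A) q} (a : Obj A p) (u : Hom p q) →
             μ ≈ᴰ ⌜ u ⌝ ↙ᴰ corep A a → (F ♮) ⁎ · μ ≈ᴰ ⌜ u ⌝ ↙ᴰ corep A′ (F · a)
    member {μ = μ} a u e = ⊑-antisym
      (mk⊑ λ y → ↙ᴰ-intro ⌜ u ⌝ (corep A′ (F · a)) λ { ∗ →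
          ↙ᴰ-elim μ (F ♮) a ⨾ idʳ≥ ⨾ ∘-mono (le (≈⇒⊑ e) a) (QCat.hom-id A a)
        ⨾ ↙ᴰ-elim ⌜ u ⌝ (corep A a) ∗ })
      (mk⊑ λ y → ↙ᴰ-intro μ (F ♮) λ x →
          ↙ᴰ-intro ⌜ u ⌝ (corep A a) (λ { ∗ →
              assoc≤ ⨾ ∘-monoʳ _ (∘-monoʳ _ (QFunctor.mono F a x) ⨾ A′.hom-∘ _ _ _)
            ⨾ ↙ᴰ-elim ⌜ u ⌝ (corep A′ (F · a)) ∗ })
        ⨾ le (≈⇒⊒ e) x)

  ▷₁ : ∀ {Φ Ψ} → ChuTransform Φ Ψ → ChuTransform (chu (dist Ψ ^▷)) (chu (dist Φ ^▷))
  ▷₁ {Φ} {Ψ} f = record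
    { F      = G
    ; G      = bar F
    ; app-FG = λ { b (μ , m) → antisym
        (↙ᴰ-intro (ev Ψ) (dist Ψ) {z = bar F · (μ , m)} λ a′ → ↙ᴰ-intro μ (F ♮) {z = ∗} (λ a →
            assoc≤ ⨾ ∘-monoʳ _ (Dist.actʳ (dist Ψ) (F · a) a′ b ⨾ ≤-reflexive (app-FG a b))
          ⨾ ↙ᴰ-elim (ev Φ) (dist Φ) a {z = μ , m}))
        (↙ᴰ-intro (ev Φ) (dist Φ) {z = μ , m} λ a →
            ∘-monoʳ _ (≥-reflexive (app-FG a b))
          ⨾ ↙ᴰ-elim (ev Ψ) (dist Ψ) (F · a) {z = bar F · (μ , m)}
          ⨾ idʳ≥ ⨾ ∘-monoʳ _ (QCat.hom-id (dom Ψ) (F · a)) ⨾ ↙ᴰ-elim μ (F ♮) a) }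
    }
    where
    open ChuTransform f
    ev : ∀ (X : ChuObj) → Dist (dom X) (Bar (dom X))
    ev X = evalOn (BarSubset (dom X))

  ▷ : Functor (op Chu) Chu
  ▷ = record
    { F₀           = λ Φ → chu (dist Φ ^▷)
    ; F₁           = ▷₁
    ; cong         = λ {_} {_} {f} {g} (d , e) →
        e , λ (μ , _) → ♮⁎-cong {F = F f} {F g} d μ
    ; identity     = λ {Φ} → (λ _ → QCat.Fibre.refl (cod Φ)) , λ (μ , _) → ♮⁎-id μ
    ; homomorphism = λ {_} {_} {Z} g f →
        (λ _ → QCat.Fibre.refl (cod Z)) , λ (μ , _) → ♮⁎-∘ (F f) (F g) μ
    } where open ChuTransform

  record IsClosure {A} (c : QFunctor (P A) (P A)) : Set ℓ where
    field
      extensive  : ∀ {q} (μ : Obj (P A) q) → μ ⊑ c · μ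
      idempotent : ∀ {q} (μ : Obj (P A) q) → c · (c · μ) ⊑ c · μ

    monotone : ∀ {q} {μ ν : Obj (P A) q} → μ ⊑ ν → c · μ ⊑ c · ν
    monotone {_} {μ} {ν} l = ≼⇒⊑ (c · μ) (c · ν) (QFunctor.map-≼ c {_} {μ} {ν} (⊑⇒≼ l))

    closed : ∀ {q} (μ : Obj (P A) q) → c · μ ∈ Fix c
    closed μ = ⊑-antisym (idempotent μ) (extensive (c · μ))

  Fix-separated : ∀ {A} {c : QFunctor (P A) (P A)} → Separated (P A ∣ Fix c)
  Fix-separated (μ , _) (ν , _) = P-separated μ ν

  Fix-complete : ∀ {A} {c : QFunctor (P A) (P A)} → IsClosure c → Complete (P A ∣ Fix c)
  Fix-complete {A} {c} isC M = record
    { sup    = c · σ M , closed (σ M)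
    ; is-sup = λ (ν , n) → antisym (below M ν n) (above M ν n)
    }
    where
    open IsClosure isC
    C : QCat
    C = P A ∣ Fix c

    ev : Dist A C
    ev = evalOn (Fix c)

    σ : ∀ {q} → Obj (P C) q → Obj (P A) q
    σ M = M ∘ᴰ ev

    below : ∀ {q r} (M : Obj (P C) q) (ν : Obj (P A) r) (n : ν ∈ Fix c) →
            hom (P A) (c · σ M) ν ≤ app (idᴰ C ↙ᴰ M) ∗ (ν , n)
    below M ν n = ↙ᴰ-intro (idᴰ C) M {z = ν , n} λ { (μ , m) → P-intro μ ν λ x →
        assoc≤ ⨾ ∘-monoʳ _ (∘ᴰ-upper M ev (μ , m) ⨾ le (extensive (σ M)) x)
      ⨾ P-elim (c · σ M) ν ≤-refl x }

    above : ∀ {q r} (M : Obj (P C) q) (ν : Obj (P A) r) (n : ν ∈ Fix c) →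
            app (idᴰ C ↙ᴰ M) ∗ (ν , n) ≤ hom (P A) (c · σ M) ν
    above M ν n =
        P-intro (σ M) ν (λ x → ≤-reflexive (∘-⋁ˡ _ _) ⨾ ⋁-least _ λ { (_ , (μ , m)) →
          assoc≥ ⨾ P-elim μ ν (↙ᴰ-elim (idᴰ C) M (μ , m) {z = ν , n}) x })
      ⨾ QFunctor.mono c (σ M) ν
      ⨾ P-intro (c · σ M) ν (λ x →
          P-elim (c · σ M) (c · ν) ≤-refl x ⨾ le (≈⇒⊑ n) x)

  -- μ ↦ μ(F -), which is (F_♮)^* up to ≈.
  pull : ∀ {A A′} → QFunctor A A′ → QFunctor (P A′) (P A)
  pull {A} {A′} F = record
    { map  = pullback
    ; cong = λ e → mk≈ λ x y → at e (F · x) y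
    ; mono = λ μ μ′ → P-intro (pullback μ) (pullback μ′) λ x → P-elim μ μ′ ≤-refl (F · x)
    }
    where
    pullback : ∀ {q} → Obj (P A′) q → Obj (P A) q
    pullback μ = record
      { app = λ x y → app μ (F · x) y
      ; act = λ x′ x y y′ →
          ∘-monoʳ _ (∘-monoʳ _ (QFunctor.mono F x′ x)) ⨾ Dist.act μ _ _ y y′
      }

  transpose : ∀ {A A′} (F : QFunctor A A′) {q} {μ : Obj (P A) q} {ν : Obj (P A′) q} →
              (♮ F) ^* · μ ⊑ ν → μ ⊑ pull F · ν
  transpose {A′ = A′} F {μ = μ} l = mk⊑ λ x →
    idʳ≥ ⨾ ∘-monoʳ _ (QCat.hom-id A′ (F · x)) ⨾ ∘ᴰ-upper μ (♮ F) x ⨾ le l (F · x)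

  untranspose : ∀ {A A′} (F : QFunctor A A′) {q} {μ : Obj (P A) q} {ν : Obj (P A′) q} →
                μ ⊑ pull F · ν → (♮ F) ^* · μ ⊑ ν
  untranspose F {μ = μ} {ν} l = mk⊑ λ y → ∘ᴰ-least μ (♮ F) λ x →
    ∘-monoˡ _ (le l x) ⨾ Dist.actʳ ν y (F · x) ∗

  pull-⊑ : ∀ {A A′} (F : QFunctor A A′) {q} {μ ν : Obj (P A′) q} →
           μ ⊑ ν → pull F · μ ⊑ pull F · ν
  pull-⊑ F l = mk⊑ λ x → le l (F · x)

  Continuous : ∀ {A A′} → QFunctor (P A) (P A) → QFunctor (P A′) (P A′) → QFunctor A A′ → Set ℓ
  Continuous {A} {A′} c c′ F = ∀ {q} (ν : Obj (P A′) q) → c · (pull F · ν) ⊑ pull F · (c′ · ν)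

  closed-pull : ∀ {A A′} {c : QFunctor (P A) (P A)} (c′ : QFunctor (P A′) (P A′)) →
                IsClosure c → {F : QFunctor A A′} → Continuous c c′ F →
                ∀ {q} (ν : Obj (P A′) q) → ν ∈ Fix c′ → pull F · ν ∈ Fix c
  closed-pull c′ isC {F} cont ν n =
    ⊑-antisym (⊑-trans (cont ν) (pull-⊑ F (≈⇒⊑ n))) (IsClosure.extensive isC (pull F · ν))

  least : ∀ {A} {c : QFunctor (P A) (P A)} → IsClosure c → ∀ {q} (μ ν : Obj (P A) q) →
          ν ∈ Fix c → μ ⊑ ν → c · μ ⊑ ν
  least isC μ ν n l = ⊑-trans (IsClosure.monotone isC l) (≈⇒⊑ n)

  module Lifting {A A′} (c : QFunctor (P A) (P A)) (c′ : QFunctor (P A′) (P A′))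
              (isC : IsClosure c) (isC′ : IsClosure c′) where
    private
      module C  = IsClosure isC
      module C′ = IsClosure isC′

    -- For c = φ^↓φ_↑ or c = φ_*φ^* these are the morphism parts of M and K.
    fun-lift : QFunctor A A′ → QFunctor (P A ∣ Fix c) (P A′ ∣ Fix c′)
    fun-lift F = record
      { map  = λ (μ , _) → (c′ ∘Q (♮ F) ^*) · μ , C′.closed ((♮ F) ^* · μ)
      ; cong = QFunctor.cong (c′ ∘Q (♮ F) ^*)
      ; mono = λ (μ , _) (ν , _) → QFunctor.mono (c′ ∘Q (♮ F) ^*) μ ν
      }

    lift-LA : (F : QFunctor A A′) → Continuous c c′ F →
              LeftAdjoint (P A ∣ Fix c) (P A′ ∣ Fix c′)
    lift-LA F cont = record
      { fun           = fun-lift F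
      ; isLeftAdjoint = record
          { right  = record
              { map  = λ (ν , n) → pull F · ν , closed-pull c′ isC {F} cont ν n
              ; cong = QFunctor.cong (pull F)
              ; mono = λ (μ , _) (ν , _) → QFunctor.mono (pull F) μ ν
              }
          ; unit   = λ (μ , _) → ⊑⇒≼ (transpose F {μ = μ} (C′.extensive ((♮ F) ^* · μ)))
          ; counit = λ (ν , n) → ⊑⇒≼ (least isC′ ((♮ F) ^* · (pull F · ν)) ν n
                       (untranspose F {ν = ν} ⊑-refl))
          }
      }

    lift-cong : {F F′ : QFunctor A A′} → F ≈Q F′ → fun-lift F ≈Q fun-lift F′
    lift-cong {F} {F′} e (μ , _) = ⊑-antisym
        (half {F} {F′} e) (half {F′} {F} λ x → QCat.Fibre.sym A′ (e x))
      where
      half : ∀ {F F′ : QFunctor A A′} → F ≈Q F′ →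
             c′ · ((♮ F) ^* · μ) ⊑ c′ · ((♮ F′) ^* · μ)
      half {F} {F′} e = C′.monotone (untranspose F {μ = μ}
        (⊑-trans (transpose F′ {μ = μ} ⊑-refl)
          (mk⊑ λ x → ≥-reflexive (Dist.app-congˡ ((♮ F′) ^* · μ) ∗ (e x)))))

  lift-id : ∀ {A} (c : QFunctor (P A) (P A)) (isC : IsClosure c) →
            Lifting.fun-lift c c isC isC idQ ≈Q idQ
  lift-id c isC (μ , m) = ⊑-antisym
    (least isC ((♮ idQ) ^* · μ) μ m (untranspose idQ {μ = μ} {μ} (mk⊑ λ x → ≤-refl)))
    (mk⊑ (le (transpose idQ {μ = μ} (IsClosure.extensive isC ((♮ idQ) ^* · μ)))))

  lift-∘ : ∀ {A A′ A″} (c : QFunctor (P A) (P A)) (c′ : QFunctor (P A′) (P A′))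
           (c″ : QFunctor (P A″) (P A″)) (isC : IsClosure c) (isC′ : IsClosure c′)
           (isC″ : IsClosure c″) (G : QFunctor A′ A″) (F : QFunctor A A′) →
           Continuous c′ c″ G →
           Lifting.fun-lift c c″ isC isC″ (G ∘Q F) ≈Q
           Lifting.fun-lift c′ c″ isC′ isC″ G ∘Q Lifting.fun-lift c c′ isC isC′ F
  lift-∘ {A} {A′} {A″} c c′ c″ isC isC′ isC″ G F contG {q} (μ , _) = ⊑-antisym
      (least isC″ ((♮ (G ∘Q F)) ^* · μ) right (C″.closed _)
        (untranspose (G ∘Q F) {μ = μ} {right}
          (⊑-trans (transpose F {μ = μ} ⊑-refl)
            (mk⊑ λ x → le (C′.extensive ((♮ F) ^* · μ)) (F · x)
                     ⨾ le (transpose G {μ = mid} (C″.extensive ((♮ G) ^* · mid))) (F · x)))))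
      (least isC″ ((♮ G) ^* · mid) left (C″.closed _)
        (untranspose G {μ = mid}
          (least isC′ ((♮ F) ^* · μ) (pull G · left)
            (closed-pull c″ isC′ {G} contG left (C″.closed _))
            (untranspose F {μ = μ} {pull G · left}
              (mk⊑ (le (transpose (G ∘Q F) {μ = μ} (C″.extensive ((♮ (G ∘Q F)) ^* · μ)))))))))
    where
    module C′ = IsClosure isC′
    module C″ = IsClosure isC″
    mid : Obj (P A′) q
    mid = c′ · ((♮ F) ^* · μ)
    left right : Obj (P A″) q
    left  = c″ · ((♮ (G ∘Q F)) ^* · μ)
    right = c″ · ((♮ G) ^* · mid)

  M-closure : ∀ {A B} (φ : Dist A B) → IsClosure (φ ↓ ∘Q φ ↑)
  M-closure {A} {B} φ = record
    { extensive  = ext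
    ; idempotent = λ μ → mk⊑ λ x → ↘ᴰ-intro (φ ↙ᴰ μ) φ λ y →
          ∘-monoˡ _ (↙ᴰ-intro φ (φ ↓ · (φ ↑ · μ)) λ x → ↘ᴰ-elim (φ ↙ᴰ μ) φ y)
        ⨾ ↘ᴰ-elim (φ ↙ᴰ (φ ↓ · (φ ↑ · μ))) φ y
    }
    where
    ext : ∀ {q} (μ : Obj (P A) q) → μ ⊑ φ ↓ · (φ ↑ · μ)
    ext μ = mk⊑ λ x → ↘ᴰ-intro (φ ↙ᴰ μ) φ λ y → ↙ᴰ-elim φ μ x

  K-closure : ∀ {A B} (φ : Dist A B) → IsClosure (φ ⁎ ∘Q φ ^*)
  K-closure φ = record
    { extensive  = λ ν → mk⊑ λ y → ↙ᴰ-intro (ν ∘ᴰ φ) φ λ x → ∘ᴰ-upper ν φ y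
    ; idempotent = λ ν → mk⊑ λ y → ↙ᴰ-intro (ν ∘ᴰ φ) φ λ x →
          ↙ᴰ-elim ((φ ⁎ · (φ ^* · ν)) ∘ᴰ φ) φ x
        ⨾ ∘ᴰ-least (φ ⁎ · (φ ^* · ν)) φ (λ y′ → ↙ᴰ-elim (ν ∘ᴰ φ) φ x)
    }

  module _ {Φ Ψ : ChuObj} (f : ChuTransform Φ Ψ) where
    open ChuTransform f
    private
      φ = dist Φ
      ψ = dist Ψ

    M-continuous : Continuous (φ ↓ ∘Q φ ↑) (ψ ↓ ∘Q ψ ↑) F
    M-continuous ν = mk⊑ λ x → ↘ᴰ-intro (ψ ↙ᴰ ν) ψ λ b →
        ∘-monoˡ _ (↙ᴰ-intro φ (pull F · ν) λ a →
          ↙ᴰ-elim ψ ν (F · a) ⨾ ≤-reflexive (app-FG a b))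
      ⨾ ↘ᴰ-elim (φ ↙ᴰ (pull F · ν)) φ (G · b)
      ⨾ ≥-reflexive (app-FG x b)

    K-continuous : Continuous (ψ ⁎ ∘Q ψ ^*) (φ ⁎ ∘Q φ ^*) G
    K-continuous ν = mk⊑ λ b → ↙ᴰ-intro (ν ∘ᴰ φ) φ λ a →
        ∘-monoʳ _ (≥-reflexive (app-FG a b))
      ⨾ ↙ᴰ-elim ((pull G · ν) ∘ᴰ ψ) ψ (F · a)
      ⨾ ∘ᴰ-least (pull G · ν) ψ λ b′ →
          ∘-monoʳ _ (≤-reflexive (app-FG a b′)) ⨾ ∘ᴰ-upper ν φ (G · b′)

    M₁ : LeftAdjoint (P (dom Φ) ∣ M₀ φ) (P (dom Ψ) ∣ M₀ ψ)
    M₁ = Lifting.lift-LA (φ ↓ ∘Q φ ↑) (ψ ↓ ∘Q ψ ↑) (M-closure φ) (M-closure ψ) F M-continuous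

    K₁ : LeftAdjoint (P (cod Ψ) ∣ K₀ ψ) (P (cod Φ) ∣ K₀ φ)
    K₁ = Lifting.lift-LA (ψ ⁎ ∘Q ψ ^*) (φ ⁎ ∘Q φ ^*) (K-closure ψ) (K-closure φ) G K-continuous

  M : Functor Chu Sup
  M = record
    { F₀           = λ Φ → record
        { cat       = P (dom Φ) ∣ M₀ (dist Φ)
        ; separated = Fix-separated {c = m Φ}
        ; complete  = Fix-complete (M-closure (dist Φ))
        }
    ; F₁           = M₁
    ; cong         = λ {Φ} {Ψ} {f} {g} (d , _) →
        Lifting.lift-cong (m Φ) (m Ψ) (M-closure (dist Φ)) (M-closure (dist Ψ)) {F f} {F g} d
    ; identity     = λ {Φ} → lift-id (m Φ) (M-closure (dist Φ))
    ; homomorphism = λ {X} {Y} {Z} g f → lift-∘ (m X) (m Y) (m Z)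
        (M-closure (dist X)) (M-closure (dist Y)) (M-closure (dist Z)) (F g) (F f) (M-continuous g)
    }
    where
    open ChuTransform
    m : ∀ Φ → QFunctor (P (dom Φ)) (P (dom Φ))
    m Φ = dist Φ ↓ ∘Q dist Φ ↑

  K : Functor (op Chu) Sup
  K = record
    { F₀           = λ Φ → record
        { cat       = P (cod Φ) ∣ K₀ (dist Φ)
        ; separated = Fix-separated {c = k Φ}
        ; complete  = Fix-complete (K-closure (dist Φ))
        }
    ; F₁           = K₁
    ; cong         = λ {Φ} {Ψ} {f} {g} (_ , e) →
        Lifting.lift-cong (k Φ) (k Ψ) (K-closure (dist Φ)) (K-closure (dist Ψ)) {G f} {G g} e
    ; identity     = λ {Φ} → lift-id (k Φ) (K-closure (dist Φ))
    ; homomorphism = λ {X} {Y} {Z} g f → lift-∘ (k X) (k Y) (k Z)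
        (K-closure (dist X)) (K-closure (dist Y)) (K-closure (dist Z)) (G g) (G f) (K-continuous g)
    }
    where
    open ChuTransform
    k : ∀ Φ → QFunctor (P (cod Φ)) (P (cod Φ))
    k Φ = dist Φ ⁎ ∘Q dist Φ ^*

{-# OPTIONS --safe #-}
module Submission where

-- For φ : A ⇸ B the two closure operators φ_* φ^* and (φ^▷)^↓ (φ^▷)_↑ on P B
-- agree at every presheaf.  Both parts of the theorem follow at once: K φ and
-- M (φ^▷) are the sets of fixed points of these operators, and both functors send
-- a Chu transform (F , G) from φ to ψ to (G^♮)^* followed by one of them, because
-- G is the covariant part of the transform (F , G)^▷ from ψ^▷ to φ^▷.
--
-- For a presheaf ν on B and μ in Bar A, the adjunctions give
--   (φ^▷)_↑ ν (μ) = P A (ν ∘ φ , μ).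
-- So the second closure of ν is, at b, the largest w such that
--   P A (ν ∘ φ , μ) ∘ w ∘ φ(a,b) ≤ μ(a)   for all μ in Bar A and all a,
-- whereas the first is the largest w such that w ∘ φ(a,b) ≤ (ν ∘ φ)(a) for all a.
-- The latter condition implies the former by definition of P A (ν ∘ φ , μ).  For
-- the converse at a given a, the presheaf μ = (ν ∘ φ)(a) ↙ A(a,-) suffices: it
-- lies above ν ∘ φ and takes the value (ν ∘ φ)(a) at a.

open import Data.Product using (_×_; _,_; proj₁)
open import Function.Bundles using (mk⇔)
open import Relation.Binary using (Setoid)
open import Defs

module _ {ℓ} (Q : Quantaloid ℓ) where
  open Quantaloid Q using (Hom; _≤_; _≈_; id; _∘_)
  open QuantaloidProperties Q
  open QCategories Q

  -- The presheaf u ↙ A(a,-), the largest one whose value at a is at most u.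
  coreach : ∀ A {p q} → Obj A p → Hom p q → Obj (P A) q
  coreach A a u = ⌜ u ⌝ ↙ᴰ corep A a

  coreach∈Bar : ∀ A {p q} (a : Obj A p) (u : Hom p q) → coreach A a u ∈ BarSubset A
  coreach∈Bar A {p} a u = p , a , u , Setoid.refl (DistSetoid _ _)

  ⊑-coreach : ∀ {A p q} {μ : Obj (P A) q} (a : Obj A p) {u : Hom p q} →
              app μ a ∗ ≤ u → μ ⊑ coreach A a u
  ⊑-coreach {A} {μ = μ} a {u} l = mk⊑ λ x → ↙ᴰ-intro ⌜ u ⌝ (corep A a) λ { ∗ →
    Dist.actʳ μ a x ∗ ⨾ l }

  coreach-at : ∀ {A p q} (a : Obj A p) (u : Hom p q) → app (coreach A a u) a ∗ ≤ u
  coreach-at {A} a u =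
    idʳ≥ ⨾ ∘-monoʳ _ (QCat.hom-id A a) ⨾ ↙ᴰ-elim ⌜ u ⌝ (corep A a) ∗

  ▷-↑ : ∀ {A B} (φ : Dist A B) {q r} (ν : Obj (P B) q) (μ : Obj (Bar A) r) →
        app (φ ^▷ ↙ᴰ ν) ∗ μ ≈ hom (P A) (ν ∘ᴰ φ) (proj₁ μ)
  ▷-↑ {A} φ ν μ̂@(μ , _) = antisym
    (P-intro (ν ∘ᴰ φ) μ below)
    (↙ᴰ-intro (φ ^▷) ν {z = μ̂} λ b → ↙ᴰ-intro (evalOn (BarSubset A)) φ {z = μ̂} λ a →
        assoc≤ ⨾ ∘-monoʳ _ (∘ᴰ-upper ν φ b) ⨾ P-elim (ν ∘ᴰ φ) μ ≤-refl a)
    where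
    -- Transposing across ↘ reduces the claim to the single terms of the join (ν ∘ φ)(a).
    below : ∀ {p} (a : Obj A p) →
           app (φ ^▷ ↙ᴰ ν) ∗ μ̂ ∘ app (ν ∘ᴰ φ) a ∗ ≤ app μ a ∗
    below a = ↘-elim (∘ᴰ-least ν φ λ b → ↘-intro
      ( assoc≥ ⨾ ∘-monoˡ _ (↙ᴰ-elim (φ ^▷) ν b {z = μ̂})
      ⨾ ↙ᴰ-elim (evalOn (BarSubset A)) φ a {z = μ̂}))

  closures-agree : ∀ {A B} (φ : Dist A B) {q} (ν : Obj (P B) q) →
                   φ ⁎ · (φ ^* · ν) ≈ᴰ φ ^▷ ↓ · (φ ^▷ ↑ · ν)
  closures-agree {A} {B} φ {q} ν = ⊑-antisym
    (mk⊑ λ b → ↘ᴰ-intro (φ ^▷ ↙ᴰ ν) (φ ^▷) λ μ →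
      ↙ᴰ-intro ev φ {z = μ} λ a →
          assoc≤ ⨾ ∘-mono (≤-reflexive (▷-↑ φ ν μ)) (↙ᴰ-elim (ν ∘ᴰ φ) φ a)
        ⨾ P-elim (ν ∘ᴰ φ) (proj₁ μ) ≤-refl a)
    (mk⊑ λ b → ↙ᴰ-intro (ν ∘ᴰ φ) φ λ a →
        ∘-monoˡ _ (idˡ≥ ⨾ ∘-monoˡ _ (top a) ⨾ ↘ᴰ-elim (φ ^▷ ↙ᴰ ν) (φ ^▷) (test a))
      ⨾ ↙ᴰ-elim ev φ a {z = test a}
      ⨾ coreach-at a (app (ν ∘ᴰ φ) a ∗))
    where
    ev : Dist A (Bar A)
    ev = evalOn (BarSubset A)

    -- The element of Bar A that detects the condition at a.
    test : ∀ {p} → Obj A p → Obj (Bar A) q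
    test a = coreach A a (app (ν ∘ᴰ φ) a ∗) , coreach∈Bar A a _

    top : ∀ {p} (a : Obj A p) → id ≤ app (φ ^▷ ↙ᴰ ν) ∗ (test a)
    top a = ⊑⇒≼ (⊑-coreach {μ = ν ∘ᴰ φ} a ≤-refl) ⨾ ≥-reflexive (▷-↑ φ ν (test a))

proposition6p20 : ∀ {ℓ} (Q : Quantaloid ℓ) → let open QCategories Q in
    (∀ (Φ : ChuObj) → K₀ (dist Φ) ≐ M₀ (dist (Functor.F₀ ▷ Φ)))
    ×
    (∀ {Φ Ψ : ChuObj} (f : ChuTransform Φ Ψ) {q}
    (x : Obj (cat (Functor.F₀ K Ψ)) q) (y : Obj (cat (Functor.F₀ (M ∘F ▷) Ψ)) q) →
    proj₁ x ≈ᴰ proj₁ y →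
    proj₁ (fun (Functor.F₁ K f) · x) ≈ᴰ proj₁ (fun (Functor.F₁ (M ∘F ▷) f) · y))
proposition6p20 Q =
    (λ Φ ν → mk⇔ (trans (≈ᴰ-sym (closures-agree Q (dist Φ) ν)))
                 (trans (closures-agree Q (dist Φ) ν)))
  , λ {Φ} f x y e →
      trans (QFunctor.cong (dist Φ ⁎ ∘Q dist Φ ^* ∘Q (♮ ChuTransform.G f) ^*) e)
            (closures-agree Q (dist Φ) ((♮ ChuTransform.G f) ^* · proj₁ y))
  where
  open QCategories Q
  trans : ∀ {A B} {φ ψ χ : Dist A B} → φ ≈ᴰ ψ → ψ ≈ᴰ χ → φ ≈ᴰ χ
  trans {A} {B} = Setoid.trans (DistSetoid A B)
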